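{- For all impartial hypergames $x,y\in\mathcal J$, $$\gamma(x+y)=\gamma(x)\oplus\gamma(y).$$
   Context: Impartial hypergames: work in a universe of possibly non-wellfounded sets (set theory with the Antifoundation Axiom, and the Axiom of Choice). The class $\mathcal J$ of impartial hypergames is the carrier of the final coalgebra of the powerset functor $\mathcal P$ (on classes); so an impartial hypergame $x$ is a possibly non-wellfounded set of impartial hypergames (its options). Equality is bisimilarity of sets. Sum (coinductively): $x+y=\{x'+y\mid x'\in x\}\cup\{x+y'\mid y'\in y\}$. Generalized Grundy numbers: the ordinals and the formal symbols $\infty_K$ for $K\subseteq\mathrm{Ord}$ a set; $\infty$ denotes $\infty_\emptyset$. Generalized Nim sum: for ordinals $\alpha,\beta$, $\alpha\oplus\beta$ is the Nim sum, i.e. binary sum without carries (for infinite ordinals, using base-2 expansions). It is extended by $\alpha\oplus\infty_K=\infty_K\oplus\alpha=\infty_{\{k\oplus\alpha\mid k\in K\}}$ and $\infty_K\oplus\infty_H=\infty$. Generalized Grundy function: $\mathrm{mex}(S)$ is the least ordinal not in the set $S$ of ordinals. Order $\mathrm{Ord}\cup\{\bot\}$ by the flat order with bottom $\bot$, and functions $\mathcal J\to\mathrm{Ord}\cup\{\bot\}$ pointwise. For such $f$ let $\mathcal F_f(x)=\{f(y)\mid y\in x,\ f(y)\ne\bot\}$. Let $D$ be the subspace of those $f$ such that for all $x$, if $f(x)=\alpha\in\mathrm{Ord}$ then $\alpha=\mathrm{mex}(\mathcal F_f(x))$ and for every $y\in x$ with $f(y)=\bot$ there is $z\in y$ with $f(z)=\mathrm{mex}(\mathcal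 F_f(x))$. Define $T:D\to D$ by $T(f)(x)=\mathrm{mex}(\mathcal F_f(x))$ if for every $y\in x$ with $f(y)=\bot$ there is $z\in y$ with $f(z)=\mathrm{mex}(\mathcal F_f(x))$, and $T(f)(x)=\bot$ otherwise. Let $\gamma_0$ be the least fixpoint of $T$, obtained by transfinitely iterating $T$ from the constant function $\bot$. Then $\gamma(x)=\gamma_0(x)$ if $\gamma_0(x)\in\mathrm{Ord}$, and otherwise $\gamma(x)=\infty_K$ with $K=\{\gamma_0(y)\mid y\in x,\ \gamma_0(y)\neq\bot\}$. -}

module Defs where

open import Axiom.ExcludedMiddle using (ExcludedMiddle)
open import Data.Bool.Base using () renaming (T to IsTrue)
open import Data.Empty using (⊥; ⊥-elim)
open import Data.List.Base using (List; []; _∷_)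
open import Data.List.Relation.Unary.Linked using (Linked; []; [-]; _∷_)
open import Data.Maybe.Base using (Maybe; just; nothing; maybe; is-just)
open import Data.Maybe using (to-witness-T)
open import Data.Product.Base using (Σ; _×_; _,_; proj₁; proj₂)
open import Data.Sum.Base using (_⊎_; inj₁; inj₂; [_,_]′)
open import Data.Unit.Base using (⊤; tt)
open import Function.Base using (_∘_)
open import Induction.WellFounded using (Acc; acc)
open import Level using (0ℓ; Lift; lift; lower) renaming (suc to lsuc)
open import Relation.Binary.Definitions using (Tri; tri<; tri≈; tri>)
open import Relation.Binary.PropositionalEquality using (_≡_; refl)
open import Relation.Nullary using (¬_; Dec; yes; no)
open import Relation.Nullary.Construct.Add.Infimum using (_₋; ⊥₋; [_])
open import Relation.Nullary.Decidable using (True; toWitness; fromWitness; map′)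

import Relation.Binary.Construct.Add.Infimum.Equality as AddInfimumEquality
import Relation.Binary.Construct.Add.Infimum.NonStrict as AddInfimumOrder

-- Sets are types in Set, classes are types in Set₁.  A set of elements of a
-- class is given by an indexed family, of which only the range matters.

record Family (A : Set₁) : Set₁ where
  constructor family
  field
    Index : Set
    at    : Index → A

open Family public

∅ : {A : Set₁} → Family A
∅ = family ⊥ (λ ())

mapᶠ : {A B : Set₁} → (A → B) → Family A → Family B
mapᶠ f S = family (Index S) (f ∘ at S)

-- A possibly non-wellfounded set is presented by a pointed graph, and two
-- pointed graphs present the same set iff they are bisimilar.  With the
-- coalgebra structure `options`, this is the final coalgebra of the powerset
-- functor on classes: see `unfold`, `unfold-hom` and `hom-unique` below.

record J : Set₁ where
  constructor game
  field
    Node  : Set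
    Child : Node → Set
    child : (n : Node) → Child n → Node
    root  : Node

open J public

_at-node_ : (x : J) → Node x → J
x at-node n = game (Node x) (Child x) (child x) n

Option : J → Set
Option x = Child x (root x)

option : (x : J) → Option x → J
option x i = x at-node child x (root x) i

options : J → Family J
options x = family (Option x) (option x)

infix 4 _≃_
record _≃_ (x y : J) : Set₁ where
  field
    Related : Node x → Node y → Set
    forth   : ∀ {m n} → Related m n → (i : Child x m) →
              Σ (Child y n) λ j → Related (child x m i) (child y n j)
    back    : ∀ {m n} → Related m n → (j : Child y n) →
              Σ (Child x m) λ i → Related (child x m i) (child y n j)
    roots   : Related (root x) (root y)

open _≃_ public

-- The options of x + y are, definitionally, the option x i + y and the
-- x + option y j.

infixl 6 _+_
_+_ : J → J → J
x + y = game
  (Node x × Node y)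
  (λ (m , n) → Child x m ⊎ Child y n)
  (λ { (m , n) (inj₁ i) → child x m i , n
     ; (m , n) (inj₂ j) → m , child y n j })
  (root x , root y)

≃-refl : ∀ {x} → x ≃ x
≃-refl .Related m n = m ≡ n
≃-refl .forth refl i = i , refl
≃-refl .back refl j = j , refl
≃-refl .roots = refl

≃-sym : ∀ {x y} → x ≃ y → y ≃ x
≃-sym p .Related m n = Related p n m
≃-sym p .forth = back p
≃-sym p .back = forth p
≃-sym p .roots = roots p

≃-trans : ∀ {x y z} → x ≃ y → y ≃ z → x ≃ z
≃-trans {y = y} p q .Related m o = Σ (Node y) λ n → Related p m n × Related q n o
≃-trans p q .forth (n , r , s) i with forth p r i
... | j , r′ with forth q s j
...   | k , s′ = k , _ , r′ , s′
≃-trans p q .back (n , r , s) k with back q s k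
... | j , s′ with back p r j
...   | i , r′ = i , _ , r′ , s′
≃-trans p q .roots = _ , roots p , roots q

≃-forth : ∀ {x y} → x ≃ y → (i : Option x) → Σ (Option y) λ j → option x i ≃ option y j
≃-forth p i with forth p (roots p) i
... | j , r = j , record
  { Related = Related p ; forth = forth p ; back = back p ; roots = r }

≃-back : ∀ {x y} → x ≃ y → (j : Option y) → Σ (Option x) λ i → option x i ≃ option y j
≃-back p j with back p (roots p) j
... | i , r = i , record
  { Related = Related p ; forth = forth p ; back = back p ; roots = r }

-- h {x′ ∣ x′ ∈ c x} = {h x′ ∣ x′ ∈ c x}

record IsCoalgebraHom {X : Set₁} (c : X → Family X) (h : X → J) : Set₁ where
  field
    hom-forth : ∀ x (i : Index (c x)) → Σ (Option (h x)) λ j → option (h x) j ≃ h (at (c x) i)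
    hom-back  : ∀ x (j : Option (h x)) → Σ (Index (c x)) λ i → option (h x) j ≃ h (at (c x) i)

open IsCoalgebraHom public

module _ {X : Set₁} (c : X → Family X) where

  -- Paths keep the graph small although X is a class.
  data Path (x : X) : Set where
    end  : Path x
    step : (i : Index (c x)) → Path (at (c x) i) → Path x

  target : ∀ {x} → Path x → X
  target {x} end = x
  target (step i p) = target p

  extend : ∀ {x} (p : Path x) → Index (c (target p)) → Path x
  extend end i = step i end
  extend (step j p) i = step j (extend p i)

  unfold : X → J
  unfold x = game (Path x) (λ p → Index (c (target p))) extend end

  unfold-step : ∀ x (i : Index (c x)) → option (unfold x) i ≃ unfold (at (c x) i)
  unfold-step x i .Related p q = p ≡ step i q
  unfold-step x i .forth refl j = j , refl
  unfold-step x i .back refl j = j , refl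
  unfold-step x i .roots = refl

  unfold-hom : IsCoalgebraHom c unfold
  unfold-hom .hom-forth x i = i , unfold-step x i
  unfold-hom .hom-back x i = i , unfold-step x i

-- sup A f is the least ordinal strictly above all f a.  Trees are compared
-- by rank, and ordinals are trees up to _≈_; classically the order is linear.

data Ord : Set₁ where
  sup : (A : Set) → (A → Ord) → Ord

Branch : Ord → Set
Branch (sup A f) = A

branch : (α : Ord) → Branch α → Ord
branch (sup A f) = f

infix 4 _≤_ _<_ _>_ _≈_

data _≤_ (α β : Ord) : Set
data _<_ (α β : Ord) : Set

data _≤_ α β where
  ≤-intro : (∀ a → branch α a < β) → α ≤ β

data _<_ α β where
  <-intro : ∀ b → α ≤ branch β b → α < β

_>_ : Ord → Ord → Set
α > β = β < α

_≈_ : Ord → Ord → Set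
α ≈ β = α ≤ β × β ≤ α

infix 4 _∈_ _∉_ _⊆_ _≐_

_∈_ : Ord → Family Ord → Set
α ∈ S = Σ (Index S) λ i → at S i ≈ α

_∉_ : Ord → Family Ord → Set
α ∉ S = ¬ (α ∈ S)

_⊆_ : Family Ord → Family Ord → Set
S ⊆ S′ = ∀ i → at S i ∈ S′

_≐_ : Family Ord → Family Ord → Set
S ≐ S′ = S ⊆ S′ × S′ ⊆ S

0ᵒ : Ord
0ᵒ = sup ⊥ (λ ())

sucᵒ : Ord → Ord
sucᵒ α = sup ⊤ (λ _ → α)

-- The least upper bound, as opposed to the strict one given by sup.
⋁ : (A : Set) → (A → Ord) → Ord
⋁ A f = sup (Σ A λ a → Branch (f a)) (λ (a , b) → branch (f a) b)

infixl 6 _+ᵒ_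
_+ᵒ_ : Ord → Ord → Ord
α +ᵒ sup B g = sup (Branch α ⊎ B) [ branch α , (λ b → α +ᵒ g b) ]′

-- 2 ^ α is the least upper bound of 1 and all 2 ^ β + 2 ^ β for β < α.
2^_ : Ord → Ord
2^ sup A f = ⋁ (Maybe A) (maybe (λ a → 2^ f a +ᵒ 2^ f a) (sucᵒ 0ᵒ))

sum2^ : List Ord → Ord
sum2^ [] = 0ᵒ
sum2^ (e ∷ es) = 2^ e +ᵒ sum2^ es

record BinaryExpansion (α : Ord) : Set₁ where
  constructor expansion
  field
    exponents  : List Ord
    decreasing : Linked _>_ exponents
    sums       : sum2^ exponents ≈ α

open BinaryExpansion public

≤-refl : ∀ {α} → α ≤ α
≤-refl {sup A f} = ≤-intro λ a → <-intro a (≤-refl {f a})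

≤-trans : ∀ {α β δ} → α ≤ β → β ≤ δ → α ≤ δ
<-≤-trans : ∀ {α β δ} → α < β → β ≤ δ → α < δ
≤-<-trans : ∀ {α β δ} → α ≤ β → β < δ → α < δ

≤-trans (≤-intro p) q = ≤-intro λ a → <-≤-trans (p a) q
<-≤-trans (<-intro b p) (≤-intro q) = ≤-<-trans p (q b)
≤-<-trans p (<-intro c q) = <-intro c (≤-trans p q)

branch< : ∀ {α} a → branch α a < α
branch< a = <-intro a ≤-refl

<⇒≤ : ∀ {α β} → α < β → α ≤ β
<⇒≤ (<-intro b (≤-intro p)) = ≤-intro λ a → <-intro b (<⇒≤ (p a))

<-irrefl : ∀ {α} → ¬ (α < α)
<-irrefl {sup A f} (<-intro a (≤-intro p)) = <-irrefl {f a} (p a)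

≈-refl : ∀ {α} → α ≈ α
≈-refl = ≤-refl , ≤-refl

≈-sym : ∀ {α β} → α ≈ β → β ≈ α
≈-sym (p , q) = q , p

≈-trans : ∀ {α β δ} → α ≈ β → β ≈ δ → α ≈ δ
≈-trans (p , q) (r , s) = ≤-trans p r , ≤-trans s q

∈-resp-≈ : ∀ {α β S} → α ≈ β → α ∈ S → β ∈ S
∈-resp-≈ p (i , q) = i , ≈-trans q p

<-wellFounded : ∀ α → Acc _<_ α
<-wellFounded α = below α ≤-refl
  where
  below : ∀ α {β} → β ≤ α → Acc _<_ β
  below (sup A f) β≤α = acc λ δ<β → down (<-≤-trans δ<β β≤α)
    where
    down : ∀ {δ} → δ < sup A f → Acc _<_ δ
    down (<-intro a δ≤fa) = below (f a) δ≤fa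

0≤ : ∀ {α} → 0ᵒ ≤ α
0≤ = ≤-intro λ ()

+ᵒ-monoʳ : ∀ α {β δ} → β ≤ δ → α +ᵒ β ≤ α +ᵒ δ
+ᵒ-monoʳ α {sup B g} {sup D h} (≤-intro p) = ≤-intro λ
  { (inj₁ a) → <-intro (inj₁ a) ≤-refl
  ; (inj₂ b) → lemma (p b) }
  where
  lemma : ∀ {β} → β < sup D h → α +ᵒ β < α +ᵒ sup D h
  lemma (<-intro d q) = <-intro (inj₂ d) (+ᵒ-monoʳ α q)

+ᵒ-monoʳ-< : ∀ α {β δ} → β < δ → α +ᵒ β < α +ᵒ δ
+ᵒ-monoʳ-< α {δ = sup D h} (<-intro d p) = <-intro (inj₂ d) (+ᵒ-monoʳ α p)

α≤α+β : ∀ α β → α ≤ α +ᵒ β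
α≤α+β α (sup B g) = ≤-intro λ a → <-intro (inj₁ a) ≤-refl

α<α+β : ∀ α {β} → 0ᵒ < β → α < α +ᵒ β
α<α+β α p = ≤-<-trans (α≤α+β α 0ᵒ) (+ᵒ-monoʳ-< α p)

+ᵒ-monoˡ : ∀ {α β} δ → α ≤ β → α +ᵒ δ ≤ β +ᵒ δ
+ᵒ-monoˡ {α} {β} (sup D h) p@(≤-intro q) = ≤-intro λ
  { (inj₁ a) → <-≤-trans (q a) (α≤α+β β (sup D h))
  ; (inj₂ d) → <-intro (inj₂ d) (+ᵒ-monoˡ (h d) p) }

⋁-upper : ∀ {A : Set} (f : A → Ord) a → f a ≤ ⋁ A f
⋁-upper f a = ≤-intro λ b → <-intro (a , b) ≤-refl

⋁-< : ∀ {A : Set} (f : A → Ord) {δ} → δ < ⋁ A f → Σ A λ a → δ < f a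
⋁-< f (<-intro (a , b) p) = a , <-intro b p

terms : {A : Set} → (A → Ord) → Maybe A → Ord
terms f = maybe (λ a → 2^ f a +ᵒ 2^ f a) (sucᵒ 0ᵒ)

0<2^ : ∀ e → 0ᵒ < 2^ e
0<2^ (sup A f) = <-≤-trans (branch< {sucᵒ 0ᵒ} tt) (⋁-upper (terms f) nothing)

2^+2^≤ : ∀ {A : Set} (f : A → Ord) a → 2^ f a +ᵒ 2^ f a ≤ 2^ sup A f
2^+2^≤ f a = ⋁-upper (terms f) (just a)

2^-mono : ∀ {α β} → α ≤ β → 2^ α ≤ 2^ β
2^-mono {sup A f} {sup B g} (≤-intro p) = ≤-intro λ
  { (nothing , tt) → 0<2^ (sup B g)
  ; (just a , b)   → <-≤-trans (branch< b) (lemma (p a)) }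
  where
  lemma : ∀ {α} → α < sup B g → 2^ α +ᵒ 2^ α ≤ 2^ sup B g
  lemma {α} (<-intro b q) = ≤-trans
    (≤-trans (+ᵒ-monoʳ (2^ α) (2^-mono q)) (+ᵒ-monoˡ (2^ g b) (2^-mono q)))
    (2^+2^≤ g b)

α≤2^α : ∀ α → α ≤ 2^ α
α≤2^α (sup A f) = ≤-intro λ a →
  ≤-<-trans (α≤2^α (f a)) (<-≤-trans (α<α+β (2^ f a) (0<2^ (f a))) (2^+2^≤ f a))

α<2^sucα : ∀ α → α < 2^ sucᵒ α
α<2^sucα α =
  ≤-<-trans (α≤2^α α) (<-≤-trans (α<α+β (2^ α) (0<2^ α)) (2^+2^≤ (λ _ → α) tt))

open AddInfimumEquality _≈_ public using (_≈₋_; ⊥₋≈⊥₋)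
  renaming ([_] to [_]₋; ≈₋-refl to ≈₋-refl′; ≈₋-sym to ≈₋-sym′; ≈₋-trans to ≈₋-trans′)

-- The flat order: the order on Ord underlying it is equality.
open AddInfimumOrder _≈_ public using () renaming (_≤₋_ to _⊑₋_; ⊥₋≤_ to ⊥₋⊑_; [_] to [_]⊑)

infix 4 _⊑_ _≗_
_⊑_ : (f g : J → Ord ₋) → Set₁
f ⊑ g = ∀ x → f x ⊑₋ g x

_≗_ : (f g : J → Ord ₋) → Set₁
f ≗ g = ∀ x → f x ≈₋ g x

-- {f y ∣ y ∈ x, f y ≠ ⊥}
𝓕 : (J → Ord ₋) → J → Family Ord
𝓕 f x = family
  (Σ (Option x) λ i → IsTrue (is-just (f (option x i))))
  (λ (i , defined) → to-witness-T (f (option x i)) defined)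

data Grundy : Set₁ where
  ord : Ord → Grundy
  ∞_  : Family Ord → Grundy

infix 4 _≈ᴳ_
data _≈ᴳ_ : Grundy → Grundy → Set₁ where
  ord : ∀ {α β} → α ≈ β → ord α ≈ᴳ ord β
  ∞_  : ∀ {K H} → K ≐ H → ∞ K ≈ᴳ ∞ H

≈₋-refl : ∀ {m} → m ≈₋ m
≈₋-refl = ≈₋-refl′ ≈-refl

≈₋-sym : ∀ {m n} → m ≈₋ n → n ≈₋ m
≈₋-sym = ≈₋-sym′ ≈-sym

≈₋-trans : ∀ {m n o} → m ≈₋ n → n ≈₋ o → m ≈₋ o
≈₋-trans = ≈₋-trans′ ≈-trans

[]-injective : ∀ {m α β} → m ≈₋ [ α ] → m ≈₋ [ β ] → α ≈ β
[]-injective [ p ]₋ [ q ]₋ = ≈-trans (≈-sym p) q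

[]≉⊥ : ∀ {m α} → m ≈₋ [ α ] → ¬ (m ≈₋ ⊥₋)
[]≉⊥ [ p ]₋ ()

⊥-or-value : (m : Ord ₋) → m ≈₋ ⊥₋ ⊎ Σ Ord λ α → m ≈₋ [ α ]
⊥-or-value ⊥₋ = inj₁ ⊥₋≈⊥₋
⊥-or-value [ α ] = inj₂ (α , ≈₋-refl)

⊑-elim : ∀ {m n α} → m ⊑₋ n → m ≈₋ [ α ] → n ≈₋ [ α ]
⊑-elim [ p ]⊑ [ q ]₋ = [ ≈-trans (≈-sym p) q ]₋

⊑-intro : ∀ {m n} → (∀ α → m ≈₋ [ α ] → n ≈₋ [ α ]) → m ⊑₋ n
⊑-intro {⊥₋} p = ⊥₋⊑ _
⊑-intro {[ α ]} p with p α ≈₋-refl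
... | [ q ]₋ = [ ≈-sym q ]⊑

⊑-⊥ : ∀ {m n} → m ⊑₋ n → n ≈₋ ⊥₋ → m ≈₋ ⊥₋
⊑-⊥ (⊥₋⊑ _) q = ⊥₋≈⊥₋

⊑-antisym : ∀ {m n} → m ⊑₋ n → n ⊑₋ m → m ≈₋ n
⊑-antisym (⊥₋⊑ _) (⊥₋⊑ _) = ⊥₋≈⊥₋
⊑-antisym [ p ]⊑ _ = [ p ]₋

∈𝓕-intro : ∀ f x {α} i → f (option x i) ≈₋ [ α ] → α ∈ 𝓕 f x
∈𝓕-intro f x {α} i p = let d , q = lemma p in (i , d) , q
  where
  lemma : ∀ {m} → m ≈₋ [ α ] → Σ (IsTrue (is-just m)) λ d → to-witness-T m d ≈ α
  lemma [ q ]₋ = tt , q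

∈𝓕-elim : ∀ f x {α} → α ∈ 𝓕 f x → Σ (Option x) λ i → f (option x i) ≈₋ [ α ]
∈𝓕-elim f x {α} ((i , d) , p) = i , lemma (f (option x i)) d p
  where
  lemma : ∀ m (d : IsTrue (is-just m)) → to-witness-T m d ≈ α → m ≈₋ [ α ]
  lemma [ β ] d q = [ q ]₋

𝓕-mono : ∀ {f g} x {α} → f ⊑ g → α ∈ 𝓕 f x → α ∈ 𝓕 g x
𝓕-mono {f} {g} x f⊑g p =
  let i , q = ∈𝓕-elim f x p in ∈𝓕-intro g x i (⊑-elim (f⊑g (option x i)) q)

-- Excluded middle for all types also yields choice,
-- since deciding a type that is not empty produces an element of it.

module Classical (em : ExcludedMiddle (lsuc 0ℓ)) where

  em₀ : {P : Set} → Dec P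
  em₀ {P} = map′ lower lift (em {Lift (lsuc 0ℓ) P})

  stable : {P : Set} → ¬ ¬ P → P
  stable {P} ¬¬p with em₀ {P}
  ... | yes p = p
  ... | no ¬p = ⊥-elim (¬¬p ¬p)

  module _ (Q : J → J → Set₁)
    (Q-forth : ∀ {x y} → Q x y → (i : Option x) → Σ (Option y) λ j → Q (option x i) (option y j))
    (Q-back  : ∀ {x y} → Q x y → (j : Option y) → Σ (Option x) λ i → Q (option x i) (option y j))
    where

    coinduction : ∀ {x y} → Q x y → x ≃ y
    coinduction {x} {y} q .Related m n = True (em {Q (x at-node m) (y at-node n)})
    coinduction q .forth r i = let j , s = Q-forth (toWitness r) i in j , fromWitness s
    coinduction q .back r j = let i , s = Q-back (toWitness r) j in i , fromWitness s
    coinduction q .roots = fromWitness q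

  hom-unique : {X : Set₁} (c : X → Family X) {h k : X → J} →
               IsCoalgebraHom c h → IsCoalgebraHom c k → ∀ x → h x ≃ k x
  hom-unique {X} c {h} {k} H K x = coinduction
    (λ u v → Σ X λ x → u ≃ h x × v ≃ k x)
    (λ (x , p , q) i →
      let j , r = ≃-forth p i
          a , s = hom-back H x j
          l , t = hom-forth K x a
          m , w = ≃-back q l
      in m , _ , ≃-trans r s , ≃-trans w t)
    (λ (x , p , q) i →
      let j , r = ≃-forth q i
          a , s = hom-back K x j
          l , t = hom-forth H x a
          m , w = ≃-back p l
      in m , _ , ≃-trans w t , ≃-trans r s)
    (x , ≃-refl , ≃-refl)

  ≤-or-> : ∀ α β → α ≤ β ⊎ β < α
  ≤-or-> (sup A f) β@(sup B g) with em₀ {Σ A λ a → ¬ (f a < β)}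
  ... | no ∄a = inj₁ (≤-intro λ a → stable λ fa≮β → ∄a (a , fa≮β))
  ... | yes (a , fa≮β) = inj₂ (<-intro a (≤-intro gb<fa))
    where
    gb<fa : ∀ b → g b < f a
    gb<fa b with ≤-or-> (f a) (g b)
    ... | inj₁ p = ⊥-elim (fa≮β (<-intro b p))
    ... | inj₂ p = p

  ≮⇒≥ : ∀ {α β} → ¬ (α < β) → β ≤ α
  ≮⇒≥ {α} {β} α≮β with ≤-or-> β α
  ... | inj₁ p = p
  ... | inj₂ p = ⊥-elim (α≮β p)

  ≰⇒> : ∀ {α β} → ¬ (α ≤ β) → β < α
  ≰⇒> {α} {β} α≰β with ≤-or-> α β
  ... | inj₁ p = ⊥-elim (α≰β p)
  ... | inj₂ p = p

  compare : ∀ α β → Tri (α < β) (α ≈ β) (β < α)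
  compare α β with ≤-or-> α β | ≤-or-> β α
  ... | inj₁ p | inj₁ q = tri≈ (λ r → <-irrefl (<-≤-trans r q)) (p , q)
                               (λ r → <-irrefl (<-≤-trans r p))
  ... | inj₁ p | inj₂ q = tri< q (λ r → <-irrefl (<-≤-trans q (proj₂ r)))
                               (λ r → <-irrefl (<-≤-trans r p))
  ... | inj₂ p | inj₁ q = tri> (λ r → <-irrefl (<-≤-trans r q))
                               (λ r → <-irrefl (<-≤-trans p (proj₁ r))) p
  ... | inj₂ p | inj₂ q = ⊥-elim (<-irrefl (<-≤-trans p (<⇒≤ q)))

  least : (P : Ord → Set) → Σ Ord P → Σ Ord λ α → P α × (∀ β → P β → α ≤ β)
  least P (α , Pα) = search α ≤-refl Pα
    where
    search : ∀ δ {α} → α ≤ δ → P α → Σ Ord λ α → P α × (∀ β → P β → α ≤ β)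
    search (sup A f) {α} α≤δ Pα with em {Σ Ord λ β → P β × β < α}
    ... | no ∄β = α , Pα , λ β Pβ → ≮⇒≥ λ β<α → ∄β (β , Pβ , β<α)
    ... | yes (β , Pβ , β<α) = down (<-≤-trans β<α α≤δ)
      where
      down : β < sup A f → Σ Ord λ α → P α × (∀ β → P β → α ≤ β)
      down (<-intro a β≤fa) = search (f a) β≤fa Pβ

  least-∉ : (S : Family Ord) → Σ Ord λ α → α ∉ S × (∀ β → β ∉ S → α ≤ β)
  least-∉ S = least (_∉ S)
    (sup (Index S) (at S) , λ (i , p) → <-irrefl (<-≤-trans (branch< i) (proj₂ p)))

  mex : Family Ord → Ord
  mex S = proj₁ (least-∉ S)

  mex-∉ : ∀ S → mex S ∉ S
  mex-∉ S = proj₁ (proj₂ (least-∉ S))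

  mex-least : ∀ S {α} → α < mex S → α ∈ S
  mex-least S {α} α<mex = stable λ α∉S →
    <-irrefl (<-≤-trans α<mex (proj₂ (proj₂ (least-∉ S)) α α∉S))

  mex-unique : ∀ S {α} → α ∉ S → (∀ {β} → β < α → β ∈ S) → α ≈ mex S
  mex-unique S α∉S below =
    ≮⇒≥ (λ mex<α → mex-∉ S (below mex<α)) , proj₂ (proj₂ (least-∉ S)) _ α∉S

  subtract : ∀ {α} β → α ≤ β → Σ Ord λ ρ → α +ᵒ ρ ≈ β
  subtract {α} (sup B g) α≤β@(≤-intro p) = ρ , ≤-intro upper , ≤-intro lower′
    where
    ρ : Ord
    ρ = sup (Σ B λ b → α ≤ g b) (λ (b , q) → proj₁ (subtract (g b) q))

    upper : ∀ c → branch (α +ᵒ ρ) c < sup B g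
    upper (inj₁ a) = p a
    upper (inj₂ (b , q)) = <-intro b (proj₁ (proj₂ (subtract (g b) q)))

    lower′ : ∀ b → g b < α +ᵒ ρ
    lower′ b with ≤-or-> α (g b)
    ... | inj₁ q = <-intro (inj₂ (b , q)) (proj₂ (proj₂ (subtract (g b) q)))
    ... | inj₂ q = <-≤-trans q (α≤α+β α ρ)

  expand-acc : ∀ α → Acc _<_ α → BinaryExpansion α
  expand-acc α (acc rec) with ≤-or-> α 0ᵒ
  ... | inj₁ α≤0 = expansion [] [] (0≤ , α≤0)
  ... | inj₂ 0<α with least (λ e → α < 2^ e) (sucᵒ α , α<2^sucα α)
  ...   | sup A f , α<2^ , minimal with ⋁-< (terms f) α<2^
  ...     | nothing , <-intro tt α≤0 = ⊥-elim (<-irrefl (<-≤-trans 0<α α≤0))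
  ...     | just a , α<2^e+2^e = expansion (e ∷ exponents E) (link (exponents E) (decreasing E) (proj₁ (sums E)))
            ( ≤-trans (+ᵒ-monoʳ (2^ e) (proj₁ (sums E))) (proj₁ eρ)
            , ≤-trans (proj₂ eρ) (+ᵒ-monoʳ (2^ e) (proj₂ (sums E))))
    where
    e : Ord
    e = f a

    2^e≤α : 2^ e ≤ α
    2^e≤α = ≮⇒≥ λ α<2^e → <-irrefl (<-≤-trans (branch< a) (minimal e α<2^e))

    ρ : Ord
    ρ = proj₁ (subtract α 2^e≤α)

    eρ : 2^ e +ᵒ ρ ≈ α
    eρ = proj₂ (subtract α 2^e≤α)

    ρ<2^e : ρ < 2^ e
    ρ<2^e = ≰⇒> λ 2^e≤ρ →
      <-irrefl (<-≤-trans α<2^e+2^e (≤-trans (+ᵒ-monoʳ (2^ e) 2^e≤ρ) (proj₁ eρ)))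

    E : BinaryExpansion ρ
    E = expand-acc ρ (rec (<-≤-trans ρ<2^e 2^e≤α))

    link : ∀ es → Linked _>_ es → sum2^ es ≤ ρ → Linked _>_ (e ∷ es)
    link [] _ _ = [-]
    link (d ∷ ds) linked ≤ρ = d<e ∷ linked
      where
      d<e : d < e
      d<e = ≰⇒> λ e≤d → <-irrefl (<-≤-trans ρ<2^e
        (≤-trans (2^-mono e≤d) (≤-trans (α≤α+β (2^ d) (sum2^ ds)) ≤ρ)))

  expand : ∀ α → BinaryExpansion α
  expand α = expand-acc α (<-wellFounded α)

  byOrder : ∀ {d e} → Tri (d < e) (d ≈ e) (e < d) → (lt eq gt : List Ord) → List Ord
  byOrder (tri< _ _ _) lt eq gt = lt
  byOrder (tri≈ _ _ _) lt eq gt = eq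
  byOrder (tri> _ _ _) lt eq gt = gt

  -- On exponents, binary addition without carries is symmetric difference,
  -- computed here on strictly decreasing lists.  The choice of expansion is
  -- immaterial, as the exponents are unique up to _≈_.
  infixl 6 _△_
  _△_ : List Ord → List Ord → List Ord
  [] △ es = es
  (d ∷ ds) △ [] = d ∷ ds
  (d ∷ ds) △ (e ∷ es) = byOrder (compare d e)
    (e ∷ ((d ∷ ds) △ es))
    (ds △ es)
    (d ∷ (ds △ (e ∷ es)))

  infixl 6 _⊕ᵒ_ _⊕_
  _⊕ᵒ_ : Ord → Ord → Ord
  α ⊕ᵒ β = sum2^ (exponents (expand α) △ exponents (expand β))

  _⊕_ : Grundy → Grundy → Grundy
  ord α ⊕ ord β = ord (α ⊕ᵒ β)
  ord α ⊕ (∞ K) = ∞ mapᶠ (_⊕ᵒ α) K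
  (∞ K) ⊕ ord α = ∞ mapᶠ (_⊕ᵒ α) K
  (∞ K) ⊕ (∞ H) = ∞ ∅

  Reverts : (J → Ord ₋) → J → Ord → Set₁
  Reverts f x α = (i : Option x) → f (option x i) ≈₋ ⊥₋ →
    Σ (Option (option x i)) λ j → f (option (option x i) j) ≈₋ [ α ]

  record D (f : J → Ord ₋) : Set₁ where
    field
      cong-≃  : ∀ {x y} → x ≃ y → f x ≈₋ f y
      value   : ∀ x {α} → f x ≈₋ [ α ] → α ≈ mex (𝓕 f x)
      reverts : ∀ x {α} → f x ≈₋ [ α ] → Reverts f x (mex (𝓕 f x))

  open D public

  T : (J → Ord ₋) → J → Ord ₋
  T f x with em {Reverts f x (mex (𝓕 f x))}
  ... | yes _ = [ mex (𝓕 f x) ]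
  ... | no  _ = ⊥₋

  -- The ordinal satisfying P, or ⊥ if there is none.
  the : (Ord → Set₁) → Ord ₋
  the P with em {Σ Ord P}
  ... | yes (α , _) = [ α ]
  ... | no  _       = ⊥₋

  -- The transfinite iteration: stage 0 = ⊥, stage (α + 1) = T (stage α), and
  -- stage λ is the join of the earlier stages for limit λ.  All three cases
  -- are instances of: stage α is the join of T (stage β) for β < α.

  stage : Ord → J → Ord ₋
  stage (sup A f) x = the λ α → Σ A λ a → T (stage (f a)) x ≈₋ [ α ]

  γ₀ : J → Ord ₋
  γ₀ x = the λ α → Σ Ord λ σ → stage σ x ≈₋ [ α ]

  γ : J → Grundy
  γ x with γ₀ x
  ... | [ α ] = ord α
  ... | ⊥₋    = ∞ 𝓕 γ₀ x

  T-intro : ∀ f x {α} → α ≈ mex (𝓕 f x) → Reverts f x α → T f x ≈₋ [ α ]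
  T-intro f x p r with em {Reverts f x (mex (𝓕 f x))}
  ... | yes _ = [ ≈-sym p ]₋
  ... | no ¬r = ⊥-elim (¬r λ i q → let j , s = r i q in j , ≈₋-trans s [ p ]₋)

  T-elim : ∀ f x {α} → T f x ≈₋ [ α ] → α ≈ mex (𝓕 f x) × Reverts f x α
  T-elim f x p with em {Reverts f x (mex (𝓕 f x))}
  T-elim f x [ p ]₋ | yes r =
    ≈-sym p , λ i q → let j , s = r i q in j , ≈₋-trans s [ p ]₋

  D-reverts : ∀ {f} → D f → ∀ x {α} → f x ≈₋ [ α ] → Reverts f x α
  D-reverts d x p i q =
    let j , s = reverts d x p i q in j , ≈₋-trans s [ ≈-sym (value d x p) ]₋

  D-∉ : ∀ {f} → D f → ∀ x {α} → f x ≈₋ [ α ] → α ∉ 𝓕 f x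
  D-∉ {f} d x p q = mex-∉ (𝓕 f x) (∈-resp-≈ {S = 𝓕 f x} (value d x p) q)

  mkD : ∀ {f} → (∀ {x y} → x ≃ y → f x ≈₋ f y) →
        (∀ x {α} → f x ≈₋ [ α ] → α ≈ mex (𝓕 f x) × Reverts f x α) → D f
  mkD c v .cong-≃ = c
  mkD c v .value x p = proj₁ (v x p)
  mkD c v .reverts x p i q =
    let j , s = proj₂ (v x p) i q in j , ≈₋-trans s [ proj₁ (v x p) ]₋

  D⇒⊑T : ∀ {f} → D f → f ⊑ T f
  D⇒⊑T {f} d x = ⊑-intro λ α p → T-intro f x (value d x p) (D-reverts d x p)

  raise : ∀ {f g} x {α} → f ⊑ g → α ≈ mex (𝓕 f x) → Reverts f x α → α ∉ 𝓕 g x →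
          α ≈ mex (𝓕 g x) × Reverts g x α
  raise {f} {g} x f⊑g p r α∉ =
      mex-unique (𝓕 g x) α∉
        (λ β<α → 𝓕-mono x f⊑g (mex-least (𝓕 f x) (<-≤-trans β<α (proj₁ p))))
    , λ i q → let j , s = r i (⊑-⊥ (f⊑g _) q) in j , ⊑-elim (f⊑g _) s

  T-mono : ∀ {f g} → D g → f ⊑ g → T f ⊑ T g
  T-mono {f} {g} dg f⊑g x = ⊑-intro λ α p →
    let q , r = T-elim f x p
        q′ , r′ = raise x f⊑g q r λ α∈ → excluded q r (∈𝓕-elim g x α∈)
    in T-intro g x q′ r′
    where
    excluded : ∀ {α} → α ≈ mex (𝓕 f x) → Reverts f x α →
               ¬ (Σ (Option x) λ i → g (option x i) ≈₋ [ α ])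
    excluded q r (i , s) with ⊥-or-value (f (option x i))
    ... | inj₁ f⊥ = let j , t = r i f⊥ in
      D-∉ dg (option x i) s (∈𝓕-intro g (option x i) j (⊑-elim (f⊑g _) t))
    ... | inj₂ (β , fβ) = mex-∉ (𝓕 f x) (∈-resp-≈ {S = 𝓕 f x} q
      (∈𝓕-intro f x i (≈₋-trans fβ [ []-injective (⊑-elim (f⊑g _) fβ) s ]₋)))

  T-cong : ∀ {f} → D f → ∀ {x y} → x ≃ y → T f x ≈₋ T f y
  T-cong {f} d e = ⊑-antisym (half e) (half (≃-sym e))
    where
    move : ∀ {x y α} → x ≃ y → α ∈ 𝓕 f x → α ∈ 𝓕 f y
    move {x} {y} e p =
      let i , q = ∈𝓕-elim f x p
          j , e′ = ≃-forth e i
      in ∈𝓕-intro f y j (≈₋-trans (≈₋-sym (cong-≃ d e′)) q)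

    half : ∀ {x y} → x ≃ y → T f x ⊑₋ T f y
    half {x} {y} e = ⊑-intro λ α p →
      let q , r = T-elim f x p in
      T-intro f y
        (mex-unique (𝓕 f y)
          (λ α∈ → mex-∉ (𝓕 f x) (∈-resp-≈ {S = 𝓕 f x} q (move (≃-sym e) α∈)))
          (λ β<α → move e (mex-least (𝓕 f x) (<-≤-trans β<α (proj₁ q)))))
        λ j s →
          let i , e′ = ≃-back e j
              k , t = r i (≈₋-trans (cong-≃ d e′) s)
              l , e″ = ≃-forth e′ k
          in l , ≈₋-trans (≈₋-sym (cong-≃ d e″)) t

  T-D : ∀ {f} → D f → D (T f)
  T-D {f} d = mkD (T-cong d) λ x p →
    let q , r = T-elim f x p in
    raise x (D⇒⊑T d) q r λ α∈ → excluded x q r (∈𝓕-elim (T f) x α∈)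
    where
    excluded : ∀ x {α} → α ≈ mex (𝓕 f x) → Reverts f x α →
               ¬ (Σ (Option x) λ i → T f (option x i) ≈₋ [ α ])
    excluded x q r (i , s) with ⊥-or-value (f (option x i))
    ... | inj₁ f⊥ = let j , t = r i f⊥ in
      mex-∉ (𝓕 f (option x i)) (∈-resp-≈ {S = 𝓕 f (option x i)}
        (proj₁ (T-elim f (option x i) s)) (∈𝓕-intro f (option x i) j t))
    ... | inj₂ (β , fβ) = mex-∉ (𝓕 f x) (∈-resp-≈ {S = 𝓕 f x} q
      (∈𝓕-intro f x i (≈₋-trans fβ [ []-injective (⊑-elim (D⇒⊑T d _) fβ) s ]₋)))

  the-elim : ∀ P {α} → the P ≈₋ [ α ] → Σ Ord λ β → P β × β ≈ α
  the-elim P p with em {Σ Ord P}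
  the-elim P [ p ]₋ | yes (β , Pβ) = β , Pβ , p

  the-intro : ∀ P {α} → P α → (∀ {β} → P β → β ≈ α) → the P ≈₋ [ α ]
  the-intro P {α} Pα unique with em {Σ Ord P}
  ... | yes (β , Pβ) = [ unique Pβ ]₋
  ... | no ∄ = ⊥-elim (∄ (α , Pα))

  module DirectedJoin {ℓ} {I : Set ℓ} (u : I → J → Ord ₋) (uD : ∀ i → D (u i))
    (directed : ∀ i j → Σ I λ k → u i ⊑ u k × u j ⊑ u k) where

    consistent : ∀ {x α β} → (Σ I λ i → u i x ≈₋ [ α ]) → (Σ I λ j → u j x ≈₋ [ β ]) → α ≈ β
    consistent (i , p) (j , q) =
      let k , i⊑k , j⊑k = directed i j in
      []-injective (⊑-elim (i⊑k _) p) (⊑-elim (j⊑k _) q)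

    module _ (g : J → Ord ₋) (above : ∀ i → u i ⊑ g)
      (cover : ∀ {x α} → g x ≈₋ [ α ] → Σ I λ i → u i x ≈₋ [ α ]) where

      join-D : D g
      join-D = mkD (λ e → ⊑-antisym (half e) (half (≃-sym e))) λ x p →
        let i , q = cover p in
        raise x (above i) (value (uD i) x q) (D-reverts (uD i) x q) λ α∈ →
          let n , r = ∈𝓕-elim g x α∈
              j , s = cover r
              k , i⊑k , j⊑k = directed i j
          in D-∉ (uD k) x (⊑-elim (i⊑k _) q) (∈𝓕-intro (u k) x n (⊑-elim (j⊑k _) s))
        where
        half : ∀ {x y} → x ≃ y → g x ⊑₋ g y
        half e = ⊑-intro λ α p →
          let i , q = cover p in
          ⊑-elim (above i _) (≈₋-trans (≈₋-sym (cong-≃ (uD i) e)) q)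

  stage-cover : ∀ {A : Set} (f : A → Ord) {x α} → stage (sup A f) x ≈₋ [ α ] →
                Σ A λ a → T (stage (f a)) x ≈₋ [ α ]
  stage-cover f p = let _ , (a , q) , r = the-elim _ p in a , ≈₋-trans q [ r ]₋

  stage-D : ∀ α → D (stage α)
  stage-mono : ∀ α β → α ≤ β → stage α ⊑ stage β
  stage-directed : ∀ {A : Set} (f : A → Ord) a b → Σ A λ c →
                   T (stage (f a)) ⊑ T (stage (f c)) × T (stage (f b)) ⊑ T (stage (f c))
  stage-above : ∀ {A : Set} (f : A → Ord) a → T (stage (f a)) ⊑ stage (sup A f)

  ⊑-refl : ∀ {f : J → Ord ₋} → f ⊑ f
  ⊑-refl x = ⊑-intro λ _ p → p

  stage-directed f a b with ≤-or-> (f a) (f b)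
  ... | inj₁ p = b , T-mono (stage-D (f b)) (stage-mono (f a) (f b) p) , ⊑-refl
  ... | inj₂ p = a , ⊑-refl , T-mono (stage-D (f a)) (stage-mono (f b) (f a) (<⇒≤ p))

  stage-above f a x = ⊑-intro λ α p → the-intro _ (a , p) λ q →
    DirectedJoin.consistent (λ a → T (stage (f a))) (λ a → T-D (stage-D (f a)))
      (stage-directed f) q (a , p)

  stage-D (sup A f) = DirectedJoin.join-D (λ a → T (stage (f a)))
    (λ a → T-D (stage-D (f a))) (stage-directed f)
    (stage (sup A f)) (stage-above f) (stage-cover f)

  stage-mono (sup A f) (sup B g) (≤-intro p) x = ⊑-intro λ α q →
    let a , r = stage-cover f q in lift-value (p a) r
    where
    lift-value : ∀ {σ α} → σ < sup B g → T (stage σ) x ≈₋ [ α ] → stage (sup B g) x ≈₋ [ α ]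
    lift-value {σ} (<-intro b q) r = ⊑-elim (stage-above g b x)
      (⊑-elim (T-mono (stage-D (g b)) (stage-mono σ (g b) q) x) r)

  γ₀-cover : ∀ {x α} → γ₀ x ≈₋ [ α ] → Σ Ord λ σ → stage σ x ≈₋ [ α ]
  γ₀-cover p = let _ , (σ , q) , r = the-elim _ p in σ , ≈₋-trans q [ r ]₋

  stages-directed : ∀ σ τ → Σ Ord λ υ → stage σ ⊑ stage υ × stage τ ⊑ stage υ
  stages-directed σ τ with ≤-or-> σ τ
  ... | inj₁ p = τ , stage-mono σ τ p , ⊑-refl
  ... | inj₂ p = σ , ⊑-refl , stage-mono τ σ (<⇒≤ p)

  γ₀-above : ∀ σ → stage σ ⊑ γ₀
  γ₀-above σ x = ⊑-intro λ α p → the-intro _ (σ , p) λ q →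
    DirectedJoin.consistent stage stage-D stages-directed q (σ , p)

  γ₀-D : D γ₀
  γ₀-D = DirectedJoin.join-D stage stage-D stages-directed γ₀ γ₀-above γ₀-cover

  γ₀-closed : T γ₀ ⊑ γ₀
  γ₀-closed x = ⊑-intro λ α p →
    let q , r = T-elim γ₀ x p in ⊑-elim (γ₀-above (sucᵒ (σ r)) x)
      (⊑-elim (stage-above (λ _ → σ r) tt x) (T-intro (stage (σ r)) x
        (mex-unique (𝓕 (stage (σ r)) x)
          (λ α∈ → mex-∉ (𝓕 γ₀ x) (∈-resp-≈ {S = 𝓕 γ₀ x} q (𝓕-mono x (γ₀-above (σ r)) α∈)))
          (λ β<α → reached r (∈𝓕-elim γ₀ x (mex-least (𝓕 γ₀ x) (<-≤-trans β<α (proj₁ q))))))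
        (reverts′ r)))
    where
    module _ {α} (r : Reverts γ₀ x α) where
      Witness : Option x → Ord → Set₁
      Witness i σ = (Σ Ord λ β → γ₀ (option x i) ≈₋ [ β ] × stage σ (option x i) ≈₋ [ β ])
                  ⊎ (γ₀ (option x i) ≈₋ ⊥₋ ×
                     Σ (Option (option x i)) λ j → stage σ (option (option x i) j) ≈₋ [ α ])

      witness : ∀ i → Σ Ord (Witness i)
      witness i with ⊥-or-value (γ₀ (option x i))
      ... | inj₁ y⊥ = let j , s = r i y⊥ ; σ , t = γ₀-cover s in σ , inj₂ (y⊥ , j , t)
      ... | inj₂ (β , yβ) = let σ , t = γ₀-cover yβ in σ , inj₁ (β , yβ , t)

      σ : Ord
      σ = sup (Option x) (λ i → proj₁ (witness i))

      up : ∀ i → stage (proj₁ (witness i)) ⊑ stage σ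
      up i = stage-mono _ _ (<⇒≤ (branch< {σ} i))

      reverts′ : Reverts (stage σ) x α
      reverts′ i y⊥ with proj₂ (witness i) | up i
      ... | inj₁ (β , _ , s) | up-i = ⊥-elim ([]≉⊥ (⊑-elim (up-i _) s) y⊥)
      ... | inj₂ (_ , j , s) | up-i = j , ⊑-elim (up-i _) s

      reached : ∀ {β} → (Σ (Option x) λ i → γ₀ (option x i) ≈₋ [ β ]) → β ∈ 𝓕 (stage σ) x
      reached {β} (i , p) = ∈𝓕-intro (stage σ) x i lemma
        where
        lemma : stage σ (option x i) ≈₋ [ β ]
        lemma with proj₂ (witness i) | up i
        ... | inj₁ (β′ , yβ′ , s) | up-i =
          ≈₋-trans (⊑-elim (up-i _) s) [ []-injective yβ′ p ]₋
        ... | inj₂ (y⊥ , _) | _ = ⊥-elim ([]≉⊥ p y⊥)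

  record IsLeastFixpoint (f : J → Ord ₋) : Set₁ where
    field
      in-D     : D f
      fixpoint : T f ≗ f
      minimal  : ∀ g → D g → T g ≗ g → f ⊑ g

  γ₀-isLeastFixpoint : IsLeastFixpoint γ₀
  γ₀-isLeastFixpoint = record
    { in-D     = γ₀-D
    ; fixpoint = λ x → ⊑-antisym (γ₀-closed x) (D⇒⊑T γ₀-D x)
    ; minimal  = λ g dg Tg≗g x → ⊑-intro λ α p →
        let σ , q = γ₀-cover p in ⊑-elim (stage⊑ g dg Tg≗g σ x) q
    }
    where
    stage⊑ : ∀ g → D g → T g ≗ g → ∀ σ → stage σ ⊑ g
    stage⊑ g dg Tg≗g (sup A f) x = ⊑-intro λ α p →
      let a , q = stage-cover f p in
      ≈₋-trans (≈₋-sym (Tg≗g x)) (⊑-elim (T-mono dg (stage⊑ g dg Tg≗g (f a)) x) q)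

{-# OPTIONS --safe #-}

-- Write ⊥ for a position without Grundy value.  That x has value α is certified
-- by its options: every ordinal below α is the value of some option, and every
-- option either has a value other than α or can be reverted to a position of
-- value α.  If x and y have values α and β, induction on the stages at which
-- they obtain them certifies α ⊕ β for x + y.  Conversely, if x + y obtains the
-- value δ at some stage, then induction on that stage shows that x and y both
-- have values: if y has value β and x has none, the options of x certify δ ⊕ β
-- for x, and if neither has a value, all options of x do, whence x does.

module Submission where

open import Level using (0ℓ; suc)
open import Axiom.ExcludedMiddle using (ExcludedMiddle)
open import Data.Bool.Base using (Bool; true; false; _xor_)
open import Data.Bool.Properties using (xor-assoc; xor-comm; xor-same; xor-identityʳ)
open import Data.Bool.Solver using (module xor-∧-Solver)
open import Data.Empty using (⊥-elim)
open import Data.List.Base using (List; []; _∷_)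
open import Data.List.Relation.Unary.Linked using (Linked; [-]; _∷_; tail)
open import Data.Product.Base using (Σ; _×_; _,_; proj₁; proj₂)
open import Data.Sum.Base using (_⊎_; inj₁; inj₂)
open import Relation.Binary.Definitions using (Tri; tri<; tri≈; tri>)
open import Relation.Binary.PropositionalEquality
  using (_≡_; refl; sym; trans; cong; cong₂)
open import Relation.Nullary using (¬_; yes; no)
open import Relation.Nullary.Construct.Add.Infimum using (_₋; ⊥₋; [_])
open import Defs

-- Ordinal order and sums of decreasing powers of two.

<-trans : ∀ {α β δ} → α < β → β < δ → α < δ
<-trans p q = <-≤-trans p (<⇒≤ q)

<⇒≉ : ∀ {α β} → α < β → ¬ (α ≈ β)
<⇒≉ p (_ , q) = <-irrefl (<-≤-trans p q)

+ᵒ-congʳ : ∀ α {β δ} → β ≈ δ → α +ᵒ β ≈ α +ᵒ δ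
+ᵒ-congʳ α (p , q) = +ᵒ-monoʳ α p , +ᵒ-monoʳ α q

-- Some branch of `β` is at least `α`, and its doubled power is one of the terms joined in `2^ β`.
2^-doubling : ∀ {α β} → α < β → 2^ α +ᵒ 2^ α ≤ 2^ β
2^-doubling {α} {sup B g} (<-intro b p) = ≤-trans
  (≤-trans (+ᵒ-monoʳ (2^ α) (2^-mono p)) (+ᵒ-monoˡ (2^ g b) (2^-mono p)))
  (2^+2^≤ g b)

Linked-weaken : ∀ {b c es} → b ≤ c → Linked _>_ (b ∷ es) → Linked _>_ (c ∷ es)
Linked-weaken b≤c [-] = [-]
Linked-weaken b≤c (e<b ∷ l) = <-≤-trans e<b b≤c ∷ l

-- By induction the tail sums to less than `2^ e`, so the whole is less than `2^ e +ᵒ 2^ e`, which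
-- doubling bounds by `2^ b`.
sum2^<2^ : ∀ {b es} → Linked _>_ (b ∷ es) → sum2^ es < 2^ b
sum2^<2^ {b} [-] = 0<2^ b
sum2^<2^ {es = e ∷ _} (e<b ∷ l) =
  <-≤-trans (+ᵒ-monoʳ-< (2^ e) (sum2^<2^ l)) (2^-doubling e<b)

sum2^-cong : ∀ {d e} ds es → d ≈ e → sum2^ ds ≈ sum2^ es → sum2^ (d ∷ ds) ≈ sum2^ (e ∷ es)
sum2^-cong {e = e} ds es (p , q) r = ≈-trans
  (+ᵒ-monoˡ (sum2^ ds) (2^-mono p) , +ᵒ-monoˡ (sum2^ ds) (2^-mono q))
  (+ᵒ-congʳ (2^ e) r)

sum2^-mono-< : ∀ {d e} ds es → d ≈ e → sum2^ ds < sum2^ es → sum2^ (d ∷ ds) < sum2^ (e ∷ es)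
sum2^-mono-< {e = e} ds es p r =
  ≤-<-trans (+ᵒ-monoˡ (sum2^ ds) (2^-mono (proj₁ p))) (+ᵒ-monoʳ-< (2^ e) r)

xor-cancelʳ : ∀ a b → (a xor b) xor b ≡ a
xor-cancelʳ a b = trans (xor-assoc a b b)
  (trans (cong (a xor_) (xor-same b)) (xor-identityʳ a))

-- Bisimilarities between sums.

+-comm : ∀ x y → x + y ≃ y + x
+-comm x y .Related (m , n) (n′ , m′) = m ≡ m′ × n ≡ n′
+-comm x y .forth (refl , refl) (inj₁ i) = inj₂ i , refl , refl
+-comm x y .forth (refl , refl) (inj₂ j) = inj₁ j , refl , refl
+-comm x y .back (refl , refl) (inj₁ j) = inj₂ j , refl , refl
+-comm x y .back (refl , refl) (inj₂ i) = inj₁ i , refl , refl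
+-comm x y .roots = refl , refl

-- Not definitional: the pattern-matching function in _+_ takes x and y themselves
-- as arguments, including their roots.
at-node-+ : ∀ x y m n → (x + y) at-node (m , n) ≃ (x at-node m) + (y at-node n)
at-node-+ x y m n .Related = _≡_
at-node-+ x y m n .forth refl (inj₁ i) = inj₁ i , refl
at-node-+ x y m n .forth refl (inj₂ j) = inj₂ j , refl
at-node-+ x y m n .back refl (inj₁ i) = inj₁ i , refl
at-node-+ x y m n .back refl (inj₂ j) = inj₂ j , refl
at-node-+ x y m n .roots = refl

module _ (em : ExcludedMiddle (suc 0ℓ)) where
  open Classical em

  -- Lists of exponents as bit functions.

  equals : Ord → Ord → Bool
  equals α β with em₀ {α ≈ β}
  ... | yes _ = true
  ... | no  _ = false

  equals-true : ∀ {α β} → α ≈ β → equals α β ≡ true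
  equals-true {α} {β} p with em₀ {α ≈ β}
  ... | yes _ = refl
  ... | no ¬p = ⊥-elim (¬p p)

  equals-false : ∀ {α β} → ¬ (α ≈ β) → equals α β ≡ false
  equals-false {α} {β} ¬p with em₀ {α ≈ β}
  ... | yes p = ⊥-elim (¬p p)
  ... | no _ = refl

  equals-cong : ∀ {α α′ β β′} → α ≈ α′ → β ≈ β′ → equals α β ≡ equals α′ β′
  equals-cong {α} {α′} {β} {β′} p q with em₀ {α ≈ β}
  ... | yes r = sym (equals-true (≈-trans (≈-sym p) (≈-trans r q)))
  ... | no ¬r = sym (equals-false λ r → ¬r (≈-trans p (≈-trans r (≈-sym q))))

  -- The parity of the number of occurrences, which is membership in a strictly
  -- decreasing list.  Parity makes indicator-△ hold for all lists.
  indicator : List Ord → Ord → Bool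
  indicator [] c = false
  indicator (e ∷ es) c = equals c e xor indicator es c

  indicator-cong : ∀ es {c d} → c ≈ d → indicator es c ≡ indicator es d
  indicator-cong [] p = refl
  indicator-cong (e ∷ es) p = cong₂ _xor_ (equals-cong p ≈-refl) (indicator-cong es p)

  indicator-△ : ∀ ds es c → indicator (ds △ es) c ≡ indicator ds c xor indicator es c
  indicator-△ [] es c = refl
  indicator-△ (d ∷ ds) [] c = sym (xor-identityʳ _)
  indicator-△ (d ∷ ds) (e ∷ es) c = by-order (compare d e)
    (indicator-△ (d ∷ ds) es c) (indicator-△ ds es c) (indicator-△ ds (e ∷ es) c)
    where
    open xor-∧-Solver

    drop-both : ∀ a b c → b xor c ≡ (a xor b) xor (a xor c)
    drop-both true true true = refl
    drop-both true true false = refl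
    drop-both true false true = refl
    drop-both true false false = refl
    drop-both false b c = refl

    by-order : ∀ {lt eq gt} (t : Tri (d < e) (d ≈ e) (e < d)) →
      indicator lt c ≡ indicator (d ∷ ds) c xor indicator es c →
      indicator eq c ≡ indicator ds c xor indicator es c →
      indicator gt c ≡ indicator ds c xor indicator (e ∷ es) c →
      indicator (byOrder t (e ∷ lt) eq (d ∷ gt)) c
        ≡ indicator (d ∷ ds) c xor indicator (e ∷ es) c
    by-order (tri< _ _ _) p _ _ = trans
      (cong (equals c e xor_) p)
      (solve 3 (λ a b c → b :+ (a :+ c) := a :+ (b :+ c)) refl
        (indicator (d ∷ ds) c) (equals c e) (indicator es c))
    -- The shared exponent is dropped by `△`, and its two occurrences cancel in the parity.
    by-order (tri≈ _ d≈e _) _ p _ = trans p (trans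
      (drop-both (equals c d) (indicator ds c) (indicator es c))
      (cong (λ b → (equals c d xor indicator ds c) xor (b xor indicator es c))
        (equals-cong ≈-refl d≈e)))
    by-order (tri> _ _ _) _ _ p = trans
      (cong (equals c d xor_) p)
      (sym (xor-assoc (equals c d) (indicator ds c) (indicator (e ∷ es) c)))

  -- The head of `ds △ es` depends on later comparisons, since equal heads vanish. Carrying a bound
  -- `b` above both lists makes the induction work.
  Linked-△-below : ∀ b ds es → Linked _>_ (b ∷ ds) → Linked _>_ (b ∷ es) →
                   Linked _>_ (b ∷ (ds △ es))
  Linked-△-below b [] es l m = m
  Linked-△-below b (d ∷ ds) [] l m = l
  Linked-△-below b (d ∷ ds) (e ∷ es) (d<b ∷ l) (e<b ∷ m) = by-order (compare d e)
    (λ d<e → Linked-△-below e (d ∷ ds) es (d<e ∷ l) m)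
    (Linked-△-below b ds es
      (Linked-weaken (<⇒≤ d<b) l) (Linked-weaken (<⇒≤ e<b) m))
    (λ e<d → Linked-△-below d ds (e ∷ es) l (e<d ∷ m))
    where
    by-order : ∀ {lt eq gt} (t : Tri (d < e) (d ≈ e) (e < d)) →
      (d < e → Linked _>_ (e ∷ lt)) → Linked _>_ (b ∷ eq) → (e < d → Linked _>_ (d ∷ gt)) →
      Linked _>_ (b ∷ byOrder t (e ∷ lt) eq (d ∷ gt))
    by-order (tri< d<e _ _) p _ _ = e<b ∷ p d<e
    by-order (tri≈ _ _ _) _ p _ = p
    by-order (tri> _ _ e<d) _ _ p = d<b ∷ p e<d

  Linked-△ : ∀ ds es → Linked _>_ ds → Linked _>_ es → Linked _>_ (ds △ es)
  Linked-△ [] es l m = m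
  Linked-△ (d ∷ ds) [] l m = l
  Linked-△ (d ∷ ds) (e ∷ es) l m with compare d e
  ... | tri< d<e _ _ = Linked-△-below e (d ∷ ds) es (d<e ∷ l) m
  ... | tri≈ _ _ _ = Linked-△ ds es (tail l) (tail m)
  ... | tri> _ _ e<d = Linked-△-below d ds (e ∷ es) l (e<d ∷ m)

  indicator-≥ : ∀ {b c es} → Linked _>_ (b ∷ es) → b ≤ c → indicator es c ≡ false
  indicator-≥ [-] b≤c = refl
  indicator-≥ (e<b ∷ l) b≤c = cong₂ _xor_
    (equals-false λ c≈e → <⇒≉ (<-≤-trans e<b b≤c) (≈-sym c≈e))
    (indicator-≥ l (≤-trans (<⇒≤ e<b) b≤c))

  indicator-head : ∀ {e es} → Linked _>_ (e ∷ es) → indicator (e ∷ es) e ≡ true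
  indicator-head l = cong₂ _xor_ (equals-true ≈-refl) (indicator-≥ l ≤-refl)

  indicator-> : ∀ {e c es} → Linked _>_ (e ∷ es) → e < c → indicator (e ∷ es) c ≡ false
  indicator-> l e<c = indicator-≥ (e<c ∷ l) ≤-refl

  -- Ordinal order as lexicographic order of bits.

  infix 4 _≺_
  -- Lexicographic comparison from the most significant bit: `e` is the topmost position of
  -- difference, and `q` has the 1 there.
  _≺_ : (p q : Ord → Bool) → Set₁
  p ≺ q = Σ Ord λ e → p e ≡ false × q e ≡ true × (∀ c → e < c → p c ≡ q c)

  -- A joint trichotomy: an outcome known for the ordinals rules out two cases and thereby gives the
  -- outcome for the bits, and conversely.
  data Comparison (α β : Ord) (p q : Ord → Bool) : Set₁ where
    less    : α < β → p ≺ q → Comparison α β p q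
    equal   : α ≈ β → (∀ c → p c ≡ q c) → Comparison α β p q
    greater : β < α → q ≺ p → Comparison α β p q

  -- The topmost difference `c` occurs in `es`, hence is not the new head `e`. The new heads agree
  -- everywhere, so `c` remains the topmost difference.
  ≺-∷ : ∀ {d e} ds es → d ≈ e → Linked _>_ (e ∷ es) →
        indicator ds ≺ indicator es → indicator (d ∷ ds) ≺ indicator (e ∷ es)
  ≺-∷ {d} {e} ds es d≈e l (c , p , q , above) =
      c
    , cong₂ _xor_ (trans (equals-cong ≈-refl d≈e) c≠e) p
    , cong₂ _xor_ c≠e q
    , λ b c<b → cong₂ _xor_ (equals-cong ≈-refl d≈e) (above b c<b)
    where
    c≠e : equals c e ≡ false
    c≠e = equals-false λ c≈e → true≢false (trans (sym q) (indicator-≥ l (proj₂ c≈e)))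
      where
      true≢false : ¬ (true ≡ false)
      true≢false ()

  -- If the heads differ, the larger head alone exceeds the sum of the other list. If they agree,
  -- the tails decide.
  comparison : ∀ {ds es} → Linked _>_ ds → Linked _>_ es →
               Comparison (sum2^ ds) (sum2^ es) (indicator ds) (indicator es)
  comparison {[]} {[]} _ _ = equal ≈-refl λ _ → refl
  comparison {[]} {e ∷ es} _ m = less
    (<-≤-trans (0<2^ e) (α≤α+β (2^ e) (sum2^ es)))
    (e , refl , indicator-head m , λ c e<c → sym (indicator-> m e<c))
  comparison {d ∷ ds} {[]} l _ = greater
    (<-≤-trans (0<2^ d) (α≤α+β (2^ d) (sum2^ ds)))
    (d , refl , indicator-head l , λ c d<c → sym (indicator-> l d<c))
  comparison {d ∷ ds} {e ∷ es} l m with compare d e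
  ... | tri< d<e _ _ = less
    (<-≤-trans (sum2^<2^ (d<e ∷ l)) (α≤α+β (2^ e) (sum2^ es)))
    (e , indicator-> l d<e , indicator-head m ,
      λ c e<c → trans (indicator-> l (<-trans d<e e<c)) (sym (indicator-> m e<c)))
  ... | tri> _ _ e<d = greater
    (<-≤-trans (sum2^<2^ (e<d ∷ m)) (α≤α+β (2^ d) (sum2^ ds)))
    (d , indicator-> m e<d , indicator-head l ,
      λ c d<c → trans (indicator-> m (<-trans e<d d<c)) (sym (indicator-> l d<c)))
  ... | tri≈ _ d≈e _ with comparison (tail l) (tail m)
  ...   | less p q = less (sum2^-mono-< ds es d≈e p) (≺-∷ ds es d≈e m q)
  ...   | equal p q = equal (sum2^-cong ds es d≈e p)
    λ c → cong₂ _xor_ (equals-cong ≈-refl d≈e) (q c)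
  ...   | greater p q = greater
    (sum2^-mono-< es ds (≈-sym d≈e) p) (≺-∷ es ds (≈-sym d≈e) l q)

  -- Bits of an ordinal and the laws of Nim addition.

  bit : Ord → Ord → Bool
  bit α = indicator (exponents (expand α))

  -- Uniqueness of binary expansions: two expansions of one ordinal have equal sums, which leaves
  -- only the case of equal bits.
  bit-unique : ∀ {α} (E : BinaryExpansion α) c → indicator (exponents E) c ≡ bit α c
  bit-unique {α} E c with comparison (decreasing E) (decreasing (expand α))
  ... | less p _ = ⊥-elim (<⇒≉ p (≈-trans (sums E) (≈-sym (sums (expand α)))))
  ... | equal _ q = q c
  ... | greater p _ = ⊥-elim (<⇒≉ p (≈-trans (sums (expand α)) (≈-sym (sums E))))

  -- The symmetric difference is strictly decreasing, so it is itself an expansion of the Nim sum,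
  -- and uniqueness applies. With `bit-injective`, equations between Nim sums become Boolean
  -- identities.
  bit-⊕ : ∀ α β c → bit (α ⊕ᵒ β) c ≡ bit α c xor bit β c
  bit-⊕ α β c = trans
    (sym (bit-unique (expansion (ds △ es) (Linked-△ ds es l m) ≈-refl) c))
    (indicator-△ ds es c)
    where
    open BinaryExpansion (expand α) using () renaming (exponents to ds; decreasing to l)
    open BinaryExpansion (expand β) using () renaming (exponents to es; decreasing to m)

  bit-comparison : ∀ α β → Comparison α β (bit α) (bit β)
  bit-comparison α β with comparison (decreasing (expand α)) (decreasing (expand β))
  ... | less p q = less
    (<-≤-trans (≤-<-trans (proj₂ (sums (expand α))) p) (proj₁ (sums (expand β)))) q
  ... | equal p q = equal (≈-trans (≈-sym (sums (expand α))) (≈-trans p (sums (expand β)))) q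
  ... | greater p q = greater
    (<-≤-trans (≤-<-trans (proj₂ (sums (expand β))) p) (proj₁ (sums (expand α)))) q

  bit-cong : ∀ {α β} → α ≈ β → ∀ c → bit α c ≡ bit β c
  bit-cong {α} {β} α≈β with bit-comparison α β
  ... | less p _ = ⊥-elim (<⇒≉ p α≈β)
  ... | equal _ q = q
  ... | greater p _ = ⊥-elim (<⇒≉ p (≈-sym α≈β))

  ≺-irrefl : ∀ {p q : Ord → Bool} → (∀ c → p c ≡ q c) → ¬ (p ≺ q)
  ≺-irrefl r (e , pe , qe , _) with trans (sym pe) (trans (r e) qe)
  ... | ()

  bit-injective : ∀ {α β} → (∀ c → bit α c ≡ bit β c) → α ≈ β
  bit-injective {α} {β} r with bit-comparison α β
  ... | less _ p = ⊥-elim (≺-irrefl r p)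
  ... | equal p _ = p
  ... | greater _ p = ⊥-elim (≺-irrefl (λ c → sym (r c)) p)

  <⇒≺ : ∀ {α β} → α < β → bit α ≺ bit β
  <⇒≺ {α} {β} α<β with bit-comparison α β
  ... | less _ p = p
  ... | equal p _ = ⊥-elim (<⇒≉ α<β p)
  ... | greater p _ = ⊥-elim (<-irrefl (<-trans α<β p))

  -- At the higher of the two positions of difference, one comparison claims equal bits and the
  -- other distinct ones. If the positions coincide, the comparisons disagree about the bit of `α`.
  ≺-asym : ∀ {α β} → bit α ≺ bit β → ¬ (bit β ≺ bit α)
  ≺-asym {α} {β} (d , αd , βd , p) (e , βe , αe , q) with compare d e
  ≺-asym {α} {β} (d , αd , βd , p) (e , βe , αe , q) | tri< d<e _ _
    with trans (sym αe) (trans (p e d<e) βe)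
  ... | ()
  ≺-asym {α} {β} (d , αd , βd , p) (e , βe , αe , q) | tri≈ _ d≈e _
    with trans (sym αe) (trans (indicator-cong (exponents (expand α)) (≈-sym d≈e)) αd)
  ... | ()
  ≺-asym {α} {β} (d , αd , βd , p) (e , βe , αe , q) | tri> _ _ e<d
    with trans (sym βd) (trans (q d e<d) αd)
  ... | ()

  ≺⇒< : ∀ {α β} → bit α ≺ bit β → α < β
  ≺⇒< {α} {β} p with bit-comparison α β
  ... | less q _ = q
  ... | equal _ q = ⊥-elim (≺-irrefl q p)
  ... | greater _ q = ⊥-elim (≺-asym {α} {β} p q)

  ⊕ᵒ-cong : ∀ {α α′ β β′} → α ≈ α′ → β ≈ β′ → α ⊕ᵒ β ≈ α′ ⊕ᵒ β′
  ⊕ᵒ-cong {α} {α′} {β} {β′} p q = bit-injective λ c → trans (bit-⊕ α β c)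
    (trans (cong₂ _xor_ (bit-cong p c) (bit-cong q c)) (sym (bit-⊕ α′ β′ c)))

  ⊕ᵒ-comm : ∀ α β → α ⊕ᵒ β ≈ β ⊕ᵒ α
  ⊕ᵒ-comm α β = bit-injective λ c → trans (bit-⊕ α β c)
    (trans (xor-comm (bit α c) (bit β c)) (sym (bit-⊕ β α c)))

  ⊕ᵒ-cancelʳ : ∀ α β → (α ⊕ᵒ β) ⊕ᵒ β ≈ α
  ⊕ᵒ-cancelʳ α β = bit-injective λ c → trans (bit-⊕ (α ⊕ᵒ β) β c)
    (trans (cong (_xor bit β c) (bit-⊕ α β c)) (xor-cancelʳ (bit α c) (bit β c)))

  ⊕ᵒ-solveˡ : ∀ α β {δ} → α ⊕ᵒ β ≈ δ → α ≈ δ ⊕ᵒ β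
  ⊕ᵒ-solveˡ α β p = ≈-trans (≈-sym (⊕ᵒ-cancelʳ α β)) (⊕ᵒ-cong p (≈-refl {β}))

  ⊕ᵒ-injectiveˡ : ∀ α α′ β → α ⊕ᵒ β ≈ α′ ⊕ᵒ β → α ≈ α′
  ⊕ᵒ-injectiveˡ α α′ β p = ≈-trans (⊕ᵒ-solveˡ α β p) (⊕ᵒ-cancelʳ α′ β)

  -- At the topmost bit where δ and α ⊕ β differ, exactly one of α and β has a 1.
  ⊕ᵒ-below : ∀ {α β δ} → δ < α ⊕ᵒ β → δ ⊕ᵒ β < α ⊎ δ ⊕ᵒ α < β
  ⊕ᵒ-below {α} {β} {δ} δ<α⊕β with <⇒≺ δ<α⊕β
  ... | e , δe , α⊕βe , above with bit α e in αe | bit β e in βe | trans (sym (bit-⊕ α β e)) α⊕βe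
  ...   | true | true | ()
  ...   | false | false | ()
  ...   | true | false | _ = inj₁ (≺⇒<
    ( e
    , trans (bit-⊕ δ β e) (cong₂ _xor_ δe βe)
    , αe
    , λ c e<c → trans (bit-⊕ δ β c)
        (trans (cong (_xor bit β c) (trans (above c e<c) (bit-⊕ α β c)))
        (xor-cancelʳ (bit α c) (bit β c)))))
  ...   | false | true | _ = inj₂ (≺⇒<
    ( e
    , trans (bit-⊕ δ α e) (cong₂ _xor_ δe αe)
    , βe
    , λ c e<c → trans (bit-⊕ δ α c)
        (trans (cong (_xor bit α c)
          (trans (above c e<c) (trans (bit-⊕ α β c) (xor-comm (bit α c) (bit β c)))))
        (xor-cancelʳ (bit β c) (bit α c)))))

  -- Certificates, and the value of a sum of valued positions.

  Avoids : (J → Ord ₋) → J → Ord → Set₁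
  Avoids f x α = (Σ Ord λ β → f x ≈₋ [ β ] × ¬ (β ≈ α)) ⊎
                 (Σ (Option x) λ i → f (option x i) ≈₋ [ α ])

  -- Positive evidence in place of `mex` and `Reverts`. Any option may use the reverting alternative
  -- of `Avoids`, with or without a value, so certificates combine without deciding which options of
  -- a sum have values.
  record Certificate (f : J → Ord ₋) (x : J) (α : Ord) : Set₁ where
    field
      reach : ∀ {β} → β < α → Σ (Option x) λ i → f (option x i) ≈₋ [ β ]
      avoid : ∀ i → Avoids f (option x i) α

  open Certificate

  T⇒certificate : ∀ f x {α} → T f x ≈₋ [ α ] → Certificate f x α
  T⇒certificate f x p with T-elim f x p
  ... | α≈mex , r = record
    { reach = λ β<α → ∈𝓕-elim f x (mex-least (𝓕 f x) (<-≤-trans β<α (proj₁ α≈mex)))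
    ; avoid = avoid′
    }
    where
    avoid′ : ∀ i → Avoids f (option x i) _
    avoid′ i with ⊥-or-value (f (option x i))
    ... | inj₁ q = inj₂ (r i q)
    ... | inj₂ (β , q) = inj₁ (β , q , λ β≈α →
      mex-∉ (𝓕 f x) (∈𝓕-intro f x i (≈₋-trans q [ ≈-trans β≈α α≈mex ]₋)))

  γ₀⇒certificate : ∀ x {α} → γ₀ x ≈₋ [ α ] → Certificate γ₀ x α
  γ₀⇒certificate x p = T⇒certificate γ₀ x (⊑-elim (D⇒⊑T γ₀-D x) p)

  -- An option that reverts to value `α` cannot itself have value `α`, because `γ₀` lies in `D`. So
  -- `α` is the mex, `T γ₀` assigns it, and `γ₀` is closed under `T`.
  certificate⇒γ₀ : ∀ x {α} → Certificate γ₀ x α → γ₀ x ≈₋ [ α ]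
  certificate⇒γ₀ x {α} cert = ⊑-elim (γ₀-closed x) (T-intro γ₀ x
    (mex-unique (𝓕 γ₀ x) (λ α∈ → α-avoided (∈𝓕-elim γ₀ x α∈))
      λ β<α → let i , p = reach cert β<α in ∈𝓕-intro γ₀ x i p)
    reverts′)
    where
    α-avoided : ¬ (Σ (Option x) λ i → γ₀ (option x i) ≈₋ [ α ])
    α-avoided (i , p) with avoid cert i
    ... | inj₁ (β , q , β≉α) = β≉α ([]-injective q p)
    ... | inj₂ (j , q) = D-∉ γ₀-D (option x i) p (∈𝓕-intro γ₀ (option x i) j q)

    reverts′ : Reverts γ₀ x α
    reverts′ i p with avoid cert i
    ... | inj₁ (β , q , _) = ⊥-elim ([]≉⊥ q p)
    ... | inj₂ r = r

  -- By `⊕ᵒ-below`, an ordinal below `α ⊕ᵒ β` is reached by a move in one summand; options avoid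
  -- `α ⊕ᵒ β` by cancellation or by reverting in the same summand. The last two hypotheses are
  -- induction hypotheses; they range over all nodes because both options and their options are
  -- needed.
  certificate-+ : ∀ {f g x y α β} → Certificate f x α → Certificate g y β →
    (∀ m {ζ} → f (x at-node m) ≈₋ [ ζ ] → γ₀ ((x at-node m) + y) ≈₋ [ ζ ⊕ᵒ β ]) →
    (∀ n {ζ} → g (y at-node n) ≈₋ [ ζ ] → γ₀ (x + (y at-node n)) ≈₋ [ α ⊕ᵒ ζ ]) →
    Certificate γ₀ (x + y) (α ⊕ᵒ β)
  certificate-+ {f} {g} {x} {y} {α} {β} certx certy left right = record
    { reach = reach′ ; avoid = avoid′ }
    where
    left′ : ∀ m {ζ} → f (x at-node m) ≈₋ [ ζ ] →
            γ₀ ((x + y) at-node (m , root y)) ≈₋ [ ζ ⊕ᵒ β ]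
    left′ m p = ≈₋-trans (cong-≃ γ₀-D (at-node-+ x y m (root y))) (left m p)

    right′ : ∀ n {ζ} → g (y at-node n) ≈₋ [ ζ ] →
             γ₀ ((x + y) at-node (root x , n)) ≈₋ [ α ⊕ᵒ ζ ]
    right′ n p = ≈₋-trans (cong-≃ γ₀-D (at-node-+ x y (root x) n)) (right n p)

    reach′ : ∀ {δ} → δ < α ⊕ᵒ β → Σ (Option (x + y)) λ i → γ₀ (option (x + y) i) ≈₋ [ δ ]
    reach′ {δ} δ<α⊕β with ⊕ᵒ-below {α} {β} {δ} δ<α⊕β
    ... | inj₁ p = let i , q = reach certx p in
      inj₁ i , ≈₋-trans (left′ _ q) [ ⊕ᵒ-cancelʳ δ β ]₋
    ... | inj₂ p = let i , q = reach certy p in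
      inj₂ i , ≈₋-trans (right′ _ q) [ ≈-trans (⊕ᵒ-comm α (δ ⊕ᵒ α)) (⊕ᵒ-cancelʳ δ α) ]₋

    avoid′ : ∀ i → Avoids γ₀ (option (x + y) i) (α ⊕ᵒ β)
    avoid′ (inj₁ i) with avoid certx i
    ... | inj₁ (ζ , p , ζ≉α) = inj₁ (_ , left′ _ p , λ q → ζ≉α (⊕ᵒ-injectiveˡ ζ α β q))
    ... | inj₂ (j , p) = inj₂ (inj₁ j , left′ _ p)
    avoid′ (inj₂ i) with avoid certy i
    ... | inj₁ (ζ , p , ζ≉β) = inj₁ (_ , right′ _ p , λ q →
      ζ≉β (⊕ᵒ-injectiveˡ ζ β α (≈-trans (⊕ᵒ-comm ζ α) (≈-trans q (⊕ᵒ-comm α β)))))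
    ... | inj₂ (j , p) = inj₂ (inj₂ j , right′ _ p)

  -- Induction on both stages: the evidence for each summand comes from an earlier stage, so a move
  -- in one summand lowers its stage and keeps the other.
  stage-+ : ∀ σ τ x y {α β} → stage σ x ≈₋ [ α ] → stage τ y ≈₋ [ β ] →
            γ₀ (x + y) ≈₋ [ α ⊕ᵒ β ]
  stage-+ (sup A f) (sup B g) x y p q =
    let a , r = stage-cover f p
        b , s = stage-cover g q
    in certificate⇒γ₀ (x + y) (certificate-+
      (T⇒certificate (stage (f a)) x r) (T⇒certificate (stage (g b)) y s)
      (λ m t → stage-+ (f a) (sup B g) (x at-node m) y t q)
      (λ n t → stage-+ (sup A f) (g b) x (y at-node n) p t))

  γ₀-+ : ∀ x y {α β} → γ₀ x ≈₋ [ α ] → γ₀ y ≈₋ [ β ] → γ₀ (x + y) ≈₋ [ α ⊕ᵒ β ]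
  γ₀-+ x y p q =
    let σ , r = γ₀-cover p
        τ , s = γ₀-cover q
    in stage-+ σ τ x y r s

  -- Values of the summands of a valued sum.

  Valued : J → Set₁
  Valued x = Σ Ord λ α → γ₀ x ≈₋ [ α ]

  γ₀-at-+ : ∀ x y m n {α β} → γ₀ (x at-node m) ≈₋ [ α ] → γ₀ (y at-node n) ≈₋ [ β ] →
            γ₀ ((x + y) at-node (m , n)) ≈₋ [ α ⊕ᵒ β ]
  γ₀-at-+ x y m n p q =
    ≈₋-trans (cong-≃ γ₀-D (at-node-+ x y m n)) (γ₀-+ (x at-node m) (y at-node n) p q)

  -- The induction step: `f` stands for a stage at which the claim `f-valued` is known, and
  -- `T-valued` extends it to `T f`.
  module _ (f : J → Ord ₋) (f-D : D f) (f⊑γ₀ : f ⊑ γ₀)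
    (f-valued : ∀ x y {δ} → f (x + y) ≈₋ [ δ ] → Valued x × Valued y) where

    f-valued-at : ∀ x y m n {δ} → f ((x + y) at-node (m , n)) ≈₋ [ δ ] →
                  Valued (x at-node m) × Valued (y at-node n)
    f-valued-at x y m n p = f-valued (x at-node m) (y at-node n)
      (≈₋-trans (≈₋-sym (cong-≃ f-D (at-node-+ x y m n))) p)

    -- A position of the sum with a value under `f` has two valued components. Hence the positions
    -- in the certificate of `x + y` whose first component is `x`, or another position without
    -- value, are excluded, and the remaining ones yield values of options of `x` and of their
    -- options.
    difference-certificate : ∀ x y {β δ} → γ₀ x ≈₋ ⊥₋ → γ₀ y ≈₋ [ β ] →
      γ₀ (x + y) ≈₋ [ δ ] → Certificate f (x + y) δ → Certificate γ₀ x (δ ⊕ᵒ β)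
    difference-certificate x y {β} {δ} x⊥ yβ x+yδ cert = record
      { reach = reach′ ; avoid = avoid′ }
      where
      ⊥-not-summand : ∀ m n {δ′} → γ₀ (x at-node m) ≈₋ ⊥₋ →
                      ¬ (f ((x + y) at-node (m , n)) ≈₋ [ δ′ ])
      ⊥-not-summand m n ⊥ p = []≉⊥ (proj₂ (proj₁ (f-valued-at x y m n p))) ⊥

      difference : ∀ m n {β′ δ′} → γ₀ (y at-node n) ≈₋ [ β′ ] →
                   f ((x + y) at-node (m , n)) ≈₋ [ δ′ ] →
                   γ₀ (x at-node m) ≈₋ [ δ′ ⊕ᵒ β′ ]
      difference m n {β′} q p = let (α , r) , _ = f-valued-at x y m n p in
        ≈₋-trans r [ ⊕ᵒ-solveˡ α β′
          ([]-injective (γ₀-at-+ x y m n r q) (⊑-elim (f⊑γ₀ _) p)) ]₋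

      reach′ : ∀ {α} → α < δ ⊕ᵒ β → Σ (Option x) λ i → γ₀ (option x i) ≈₋ [ α ]
      reach′ {α} α<δ⊕β = by-cases (⊕ᵒ-below {δ} {β} {α} α<δ⊕β)
        where
        via-x : (Σ (Option (x + y)) λ i → f (option (x + y) i) ≈₋ [ α ⊕ᵒ β ]) →
                Σ (Option x) λ i → γ₀ (option x i) ≈₋ [ α ]
        via-x (inj₁ i , p) = i ,
          ≈₋-trans (difference (child x (root x) i) (root y) yβ p) [ ⊕ᵒ-cancelʳ α β ]₋
        via-x (inj₂ j , p) = ⊥-elim (⊥-not-summand (root x) (child y (root y) j) x⊥ p)

        -- Since `x` has no value, `x + option y j` has none under `f` and must revert to value `δ`.
        -- Only a move in `x` can do this, and the option of `x` reached has value `δ ⊕ᵒ (α ⊕ᵒ δ)`,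
        -- which is `α`.
        via-y : ∀ j → γ₀ (option y j) ≈₋ [ α ⊕ᵒ δ ] →
                Avoids f (option (x + y) (inj₂ j)) δ →
                Σ (Option x) λ i → γ₀ (option x i) ≈₋ [ α ]
        via-y j q (inj₁ (_ , p , _)) =
          ⊥-elim (⊥-not-summand (root x) (child y (root y) j) x⊥ p)
        via-y j q (inj₂ (inj₁ i , p)) = i ,
          ≈₋-trans (difference (child x (root x) i) (child y (root y) j) q p)
            [ ≈-trans (⊕ᵒ-comm δ (α ⊕ᵒ δ)) (⊕ᵒ-cancelʳ α δ) ]₋
        via-y j q (inj₂ (inj₂ k , p)) =
          ⊥-elim (⊥-not-summand (root x) (child y (child y (root y) j) k) x⊥ p)

        by-cases : α ⊕ᵒ β < δ ⊎ α ⊕ᵒ δ < β → Σ (Option x) λ i → γ₀ (option x i) ≈₋ [ α ]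
        by-cases (inj₁ α⊕β<δ) = via-x (reach cert α⊕β<δ)
        by-cases (inj₂ α⊕δ<β) = let j , q = reach (γ₀⇒certificate y yβ) α⊕δ<β in
          via-y j q (avoid cert (inj₂ j))

      avoid′ : ∀ i → Avoids γ₀ (option x i) (δ ⊕ᵒ β)
      avoid′ i with ⊥-or-value (γ₀ (option x i))
      -- Value `δ ⊕ᵒ β` here would give an option of `x + y` the value `δ` of `x + y` itself.
      ... | inj₂ (α , p) = inj₁ (α , p , λ α≈δ⊕β → D-∉ γ₀-D (x + y) x+yδ
        (∈𝓕-intro γ₀ (x + y) (inj₁ i) (≈₋-trans
          (γ₀-at-+ x y (child x (root x) i) (root y) p yβ)
          [ ≈-trans (⊕ᵒ-cong α≈δ⊕β (≈-refl {β})) (⊕ᵒ-cancelʳ δ β) ]₋)))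
      -- The option of `x` has no value, so its sum with `y` has none under `f` and reverts,
      -- necessarily by a second move in `x`.
      ... | inj₁ x′⊥ with avoid cert (inj₁ i)
      ...   | inj₁ (_ , p , _) =
        ⊥-elim (⊥-not-summand (child x (root x) i) (root y) x′⊥ p)
      ...   | inj₂ (inj₁ k , p) =
        inj₂ (k , difference (child x (child x (root x) i) k) (root y) yβ p)
      ...   | inj₂ (inj₂ j , p) =
        ⊥-elim (⊥-not-summand (child x (root x) i) (child y (root y) j) x′⊥ p)

    -- No position with second component `y` has a value under `f`. So each `option x i + y` reverts
    -- by a move in `y`, and the position reached shows that `option x i` has a value. With all
    -- options valued, `x` receives their mex.
    mex-certificate : ∀ x y {δ} → γ₀ y ≈₋ ⊥₋ → Certificate f (x + y) δ →
                      Certificate γ₀ x (mex (𝓕 γ₀ x))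
    mex-certificate x y y⊥ cert = record
      { reach = λ β< → ∈𝓕-elim γ₀ x (mex-least (𝓕 γ₀ x) β<)
      ; avoid = λ i → let α , p = option-valued i in inj₁ (α , p , λ α≈mex →
          mex-∉ (𝓕 γ₀ x) (∈𝓕-intro γ₀ x i (≈₋-trans p [ α≈mex ]₋)))
      }
      where
      y-not-summand : ∀ m {δ′} → ¬ (f ((x + y) at-node (m , root y)) ≈₋ [ δ′ ])
      y-not-summand m p = []≉⊥ (proj₂ (proj₂ (f-valued-at x y m (root y) p))) y⊥

      option-valued : ∀ i → Valued (option x i)
      option-valued i with avoid cert (inj₁ i)
      ... | inj₁ (_ , p , _) = ⊥-elim (y-not-summand _ p)
      ... | inj₂ (inj₁ k , p) = ⊥-elim (y-not-summand _ p)
      ... | inj₂ (inj₂ j , p) = proj₁ (f-valued-at x y _ _ p)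

    T-valued : ∀ x y {δ} → T f (x + y) ≈₋ [ δ ] → Valued x × Valued y
    T-valued x y {δ} p = by-cases (⊥-or-value (γ₀ x)) (⊥-or-value (γ₀ y))
      where
      T⇒γ₀ : ∀ z → T f z ≈₋ [ δ ] → γ₀ z ≈₋ [ δ ]
      T⇒γ₀ z q = ⊑-elim (γ₀-closed z) (⊑-elim (T-mono γ₀-D f⊑γ₀ z) q)

      one-sided : ∀ x y {β} → T f (x + y) ≈₋ [ δ ] → γ₀ x ≈₋ ⊥₋ → γ₀ y ≈₋ [ β ] → Valued x
      one-sided x y q x⊥ yβ = _ , certificate⇒γ₀ x
        (difference-certificate x y x⊥ yβ (T⇒γ₀ (x + y) q) (T⇒certificate f (x + y) q))

      by-cases : γ₀ x ≈₋ ⊥₋ ⊎ Valued x → γ₀ y ≈₋ ⊥₋ ⊎ Valued y → Valued x × Valued y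
      by-cases (inj₂ xα) (inj₂ yβ) = xα , yβ
      by-cases (inj₁ x⊥) (inj₂ yβ) = one-sided x y p x⊥ (proj₂ yβ) , yβ
      -- `T f` respects bisimilarity, so the summands may be exchanged.
      by-cases (inj₂ xα) (inj₁ y⊥) =
        xα , one-sided y x (≈₋-trans (T-cong f-D (+-comm y x)) p) y⊥ (proj₂ xα)
      by-cases (inj₁ x⊥) (inj₁ y⊥) = ⊥-elim ([]≉⊥
        (certificate⇒γ₀ x (mex-certificate x y y⊥ (T⇒certificate f (x + y) p))) x⊥)

  stage-valued : ∀ σ x y {δ} → stage σ (x + y) ≈₋ [ δ ] → Valued x × Valued y
  stage-valued (sup A f) x y p =
    let a , q = stage-cover f p
    in T-valued (stage (f a)) (stage-D (f a)) (γ₀-above (f a)) (stage-valued (f a)) x y q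

  summands-valued : ∀ x y {δ} → γ₀ (x + y) ≈₋ [ δ ] → Valued x × Valued y
  summands-valued x y p = let σ , q = γ₀-cover p in stage-valued σ x y q

  -- The values `∞ K` and the sum law for `γ`.

  γ-value : ∀ x {α} → γ₀ x ≈₋ [ α ] → Σ Ord λ β → γ x ≡ ord β × β ≈ α
  γ-value x p with γ₀ x
  γ-value x [ q ]₋ | [ β ] = β , refl , q

  γ-⊥ : ∀ x → γ₀ x ≈₋ ⊥₋ → γ x ≡ ∞ 𝓕 γ₀ x
  γ-⊥ x p with γ₀ x
  ... | ⊥₋ = refl

  γ₀-+-⊥ˡ : ∀ x y → γ₀ x ≈₋ ⊥₋ → γ₀ (x + y) ≈₋ ⊥₋
  γ₀-+-⊥ˡ x y x⊥ with ⊥-or-value (γ₀ (x + y))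
  ... | inj₁ p = p
  ... | inj₂ (_ , p) = ⊥-elim ([]≉⊥ (proj₂ (proj₁ (summands-valued x y p))) x⊥)

  summands-valued-at : ∀ x y m n {δ} → γ₀ ((x + y) at-node (m , n)) ≈₋ [ δ ] →
                       Valued (x at-node m) × Valued (y at-node n)
  summands-valued-at x y m n p = summands-valued (x at-node m) (y at-node n)
    (≈₋-trans (≈₋-sym (cong-≃ γ₀-D (at-node-+ x y m n))) p)

  ∈𝓕-at : ∀ f x (k : Index (𝓕 f x)) → Σ (Option x) λ i → f (option x i) ≈₋ [ at (𝓕 f x) k ]
  ∈𝓕-at f x k = ∈𝓕-elim f x (k , ≈-refl)

  -- Moves in `y` keep the valueless summand `x` and contribute nothing. A move in `x` contributes
  -- exactly when the option of `x` has a value, and that value is shifted by `β`.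
  𝓕-+-translate : ∀ x y {β} → γ₀ x ≈₋ ⊥₋ → γ₀ y ≈₋ [ β ] →
                  𝓕 γ₀ (x + y) ≐ mapᶠ (_⊕ᵒ β) (𝓕 γ₀ x)
  𝓕-+-translate x y {β} x⊥ yβ = to , from
    where
    to : 𝓕 γ₀ (x + y) ⊆ mapᶠ (_⊕ᵒ β) (𝓕 γ₀ x)
    to k with ∈𝓕-at γ₀ (x + y) k
    ... | inj₂ j , p = ⊥-elim ([]≉⊥ (proj₂ (proj₁ (summands-valued-at x y _ _ p))) x⊥)
    ... | inj₁ i , p =
      let (α , q) , _ = summands-valued-at x y _ _ p
          l , r = ∈𝓕-intro γ₀ x i q
      in l , ≈-trans (⊕ᵒ-cong r (≈-refl {β})) ([]-injective (γ₀-at-+ x y _ _ q yβ) p)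

    from : mapᶠ (_⊕ᵒ β) (𝓕 γ₀ x) ⊆ 𝓕 γ₀ (x + y)
    from k = let i , p = ∈𝓕-at γ₀ x k in
      ∈𝓕-intro γ₀ (x + y) (inj₁ i) (γ₀-at-+ x y _ _ p yβ)

  -- Every option of the sum keeps one summand without a value.
  𝓕-+-∅ : ∀ x y → γ₀ x ≈₋ ⊥₋ → γ₀ y ≈₋ ⊥₋ → 𝓕 γ₀ (x + y) ≐ ∅
  𝓕-+-∅ x y x⊥ y⊥ = to , λ ()
    where
    to : 𝓕 γ₀ (x + y) ⊆ ∅
    to k with ∈𝓕-at γ₀ (x + y) k
    ... | inj₁ i , p = ⊥-elim ([]≉⊥ (proj₂ (proj₂ (summands-valued-at x y _ _ p))) y⊥)
    ... | inj₂ j , p = ⊥-elim ([]≉⊥ (proj₂ (proj₁ (summands-valued-at x y _ _ p))) x⊥)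

  𝓕-cong : ∀ {f} → D f → ∀ {x y} → x ≃ y → 𝓕 f x ⊆ 𝓕 f y
  𝓕-cong {f} d {x} {y} e k =
    let i , p = ∈𝓕-at f x k
        j , e′ = ≃-forth e i
    in ∈𝓕-intro f y j (≈₋-trans (≈₋-sym (cong-≃ d e′)) p)

  ⊆-trans : ∀ {S S′ S″} → S ⊆ S′ → S′ ⊆ S″ → S ⊆ S″
  ⊆-trans p q i = let j , r = p i ; k , s = q j in k , ≈-trans s r

  ≐-trans : ∀ {S S′ S″} → S ≐ S′ → S′ ≐ S″ → S ≐ S″
  ≐-trans {S} {S′} {S″} (p , p′) (q , q′) =
    ⊆-trans {S} {S′} {S″} p q , ⊆-trans {S″} {S′} {S} q′ p′

  -- `γ` is defined by cases on `γ₀`; its form in each case is known as a propositional equality and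
  -- substituted here, which lets `_⊕_` reduce.
  ≈ᴳ-⊕-resp-≡ : ∀ {a a′ b b′ c c′} → a ≡ a′ → b ≡ b′ → c ≡ c′ →
                c′ ≈ᴳ a′ ⊕ b′ → c ≈ᴳ a ⊕ b
  ≈ᴳ-⊕-resp-≡ refl refl refl p = p

  γ-+ : ∀ x y → γ (x + y) ≈ᴳ γ x ⊕ γ y
  γ-+ x y = by-cases (⊥-or-value (γ₀ x)) (⊥-or-value (γ₀ y))
    where
    by-cases : γ₀ x ≈₋ ⊥₋ ⊎ Valued x → γ₀ y ≈₋ ⊥₋ ⊎ Valued y → γ (x + y) ≈ᴳ γ x ⊕ γ y
    by-cases (inj₁ x⊥) (inj₁ y⊥) =
      ≈ᴳ-⊕-resp-≡ (γ-⊥ x x⊥) (γ-⊥ y y⊥) (γ-⊥ (x + y) (γ₀-+-⊥ˡ x y x⊥))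
        (∞ 𝓕-+-∅ x y x⊥ y⊥)
    by-cases (inj₁ x⊥) (inj₂ (β , yβ)) =
      let β′ , γy , β′≈β = γ-value y yβ in
      ≈ᴳ-⊕-resp-≡ (γ-⊥ x x⊥) γy (γ-⊥ (x + y) (γ₀-+-⊥ˡ x y x⊥))
        (∞ 𝓕-+-translate x y x⊥ (≈₋-trans yβ [ ≈-sym β′≈β ]₋))
    -- `𝓕-+-translate` has the valueless summand on the left, so the sum is commuted first.
    by-cases (inj₂ (α , xα)) (inj₁ y⊥) =
      let α′ , γx , α′≈α = γ-value x xα
          x+y⊥ = ≈₋-trans (cong-≃ γ₀-D (+-comm x y)) (γ₀-+-⊥ˡ y x y⊥)
      in ≈ᴳ-⊕-resp-≡ γx (γ-⊥ y y⊥) (γ-⊥ (x + y) x+y⊥)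
        (∞ ≐-trans {𝓕 γ₀ (x + y)} {𝓕 γ₀ (y + x)} {mapᶠ (_⊕ᵒ α′) (𝓕 γ₀ y)}
          (𝓕-cong γ₀-D (+-comm x y) , 𝓕-cong γ₀-D (+-comm y x))
          (𝓕-+-translate y x y⊥ (≈₋-trans xα [ ≈-sym α′≈α ]₋)))
    by-cases (inj₂ (α , xα)) (inj₂ (β , yβ)) =
      let α′ , γx , p = γ-value x xα
          β′ , γy , q = γ-value y yβ
          δ′ , γx+y , r = γ-value (x + y) (γ₀-+ x y xα yβ)
      in ≈ᴳ-⊕-resp-≡ γx γy γx+y
        (ord (≈-trans r (⊕ᵒ-cong (≈-sym p) (≈-sym q))))

proposition5p24 : (em : ExcludedMiddle (suc 0ℓ)) → let open Classical em in
    (x y : J) → γ (x + y) ≈ᴳ γ x ⊕ γ y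
proposition5p24 = γ-+
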